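{- Let $M\subseteq N$ and $N\setminus M=D\cup E$ with $D\cap E=\emptyset$. If $m\in\mathcal{K}(N)$ then $T_{ -D|E}(m)\in\mathcal{K}(M)$, and the independency model induced by $T_{ -D|E}(m)$ is given by $$a\perp b\mid C\ [T_{ -D|E}(m)]\iff a\perp b\mid C\cup E\ [m]\qquad\text{for any }\langle a,b|C\rangle\in\mathcal{E}(M).$$ In particular, $T_{ -D|E}$ maps $\mathcal{K}(N)$ linearly into $\mathcal{K}(M)$.
   Context: $N$ is a finite set with $|N|\ge 2$ and $\mathcal{P}(N)$ is its power set; a singleton $\{a\}$ is written $a$. $\mathbb{R}^{\mathcal{P}(N)}$ is the space of functions $m:\mathcal{P}(N)\to\mathbb{R}$. A function $m$ is supermodular if $m(A)+m(B)\le m(A\cup B)+m(A\cap B)$ for all $A,B\subseteq N$; $\mathcal{K}(N)$ is the cone of supermodular functions. $\mathcal{E}(N)$ is the set of triplets $\langle a,b|C\rangle$ with $a,b\in N$ distinct and $C\subseteq N\setminus\{a,b\}$. For $m\in\mathbb{R}^{\mathcal{P}(N)}$, $a\perp b\mid C\ [m]$ means $m(a\cup b\cup C)+m(C)-m(a\cup C)-m(b\cup C)=0$; the independency model induced by $m\in\mathcal{K}(N)$ is the set of $\langle a,b|C\rangle\in\mathcal{E}(N)$ with $a\perp b\mid C\ [m]$. The same definitions are used for other finite sets in place of $N$. The minor projection with deleting of $D$ and extracting of $E$ is the map $T_{ -D|E}:\mathbb{R}^{\mathcal{P}(N)}\to\mathbb{R}^{\mathcal{P}(M)}$, $[T_{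 -D|E}(m)](S)=m(S\cup E)$ for $S\subseteq M$. -}

module Defs where

open import Algebra.Module.Bundles.Raw using (RawLeftModule)
open import Data.Fin.Base using (Fin)
open import Data.Fin.Subset
  using (Subset; _∈_; _⊆_; _∪_; _∩_; _─_; ⁅_⁆)
open import Data.Fin.Subset.Properties
open import Data.Irrelevant using ([_])
open import Data.Nat.Base as ℕ using (ℕ)
import Data.Nat.Properties as ℕ
open import Data.Product.Base using (Σ-syntax; ∃-syntax; _×_; _,_)
open import Data.Rational as ℚ using (ℚ; 0ℚ; 1ℚ; ½)
import Data.Rational.Properties as ℚ
open import Data.Rational.Solver using (module +-*-Solver)
open import Data.Refinement using (Refinement; _,_)
open import Data.Sum.Base using ([_,_]′)
open import Level using (0ℓ)
open import Relation.Binary.PropositionalEquality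
open import Relation.Unary using (Pred)

-- Real numbers are Cauchy sequences of rationals.

IsCauchy : (ℕ → ℚ) → Set
IsCauchy x = ∀ ε → 0ℚ ℚ.< ε →
  ∃[ k ] (∀ i j → k ℕ.≤ i → k ℕ.≤ j → ℚ.∣ x i ℚ.- x j ∣ ℚ.< ε)

record ℝ : Set where
  constructor _,_
  field
    seq    : ℕ → ℚ
    cauchy : IsCauchy seq
open ℝ public

infix 4 _≈_ _≤_

-- Equality of reals is this relation, not _≡_ on representatives.
_≈_ : ℝ → ℝ → Set
x ≈ y = ∀ ε → 0ℚ ℚ.< ε →
  ∃[ k ] (∀ i → k ℕ.≤ i → ℚ.∣ seq x i ℚ.- seq y i ∣ ℚ.< ε)

_≤_ : ℝ → ℝ → Set
x ≤ y = ∀ ε → 0ℚ ℚ.< ε →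
  ∃[ k ] (∀ i → k ℕ.≤ i → seq x i ℚ.< seq y i ℚ.+ ε)

private
  module _ where
    open +-*-Solver

    +-regroup : ∀ a b c d →
      (a ℚ.+ b) ℚ.- (c ℚ.+ d) ≡ (a ℚ.- c) ℚ.+ (b ℚ.- d)
    +-regroup = solve 4 (λ a b c d →
      (a :+ b) :- (c :+ d) := (a :- c) :+ (b :- d)) refl

    *-regroup : ∀ a b c d →
      a ℚ.* b ℚ.- c ℚ.* d ≡ a ℚ.* (b ℚ.- d) ℚ.+ d ℚ.* (a ℚ.- c)
    *-regroup = solve 4 (λ a b c d →
      a :* b :- c :* d := a :* (b :- d) :+ d :* (a :- c)) refl

    neg-regroup : ∀ a b → ℚ.- (a ℚ.- b) ≡ (ℚ.- a) ℚ.- (ℚ.- b)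
    neg-regroup = solve 2 (λ a b → :- (a :- b) := (:- a) :- (:- b)) refl

    split : ∀ a b → a ≡ (a ℚ.- b) ℚ.+ b
    split = solve 2 (λ a b → a := (a :- b) :+ b) refl

  half-pos : ∀ {ε} → 0ℚ ℚ.< ε → 0ℚ ℚ.< ½ ℚ.* ε
  half-pos {ε} p =
    subst (ℚ._< ½ ℚ.* ε) (ℚ.*-zeroʳ ½) (ℚ.*-monoʳ-<-pos ½ p)

  half+half : ∀ ε → ½ ℚ.* ε ℚ.+ ½ ℚ.* ε ≡ ε
  half+half ε = trans (sym (ℚ.*-distribʳ-+ ε ½ ½)) (ℚ.*-identityˡ ε)

  -- For K, L > 0 and ε > 0, some δ > 0 satisfies K δ + L δ = ε.
  divide : ∀ K L → ℚ.Positive K → ℚ.Positive L → ∀ ε → 0ℚ ℚ.< ε →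
           Σ[ δ ∈ ℚ ] 0ℚ ℚ.< δ × K ℚ.* δ ℚ.+ L ℚ.* δ ≡ ε
  divide K L K>0 L>0 ε ε>0 = r ℚ.* ε , δ>0 , eq
    where
    K+L = K ℚ.+ L
    instance
      K+L>0 : ℚ.Positive K+L
      K+L>0 = ℚ.pos+pos⇒pos K {{K>0}} L {{L>0}}
      K+L≢0 : ℚ.NonZero K+L
      K+L≢0 = ℚ.pos⇒nonZero K+L
    r = ℚ.1/ K+L
    δ>0 : 0ℚ ℚ.< r ℚ.* ε
    δ>0 = subst (ℚ._< r ℚ.* ε) (ℚ.*-zeroʳ r)
                (ℚ.*-monoʳ-<-pos r {{ℚ.1/pos⇒pos K+L}} ε>0)
    eq : K ℚ.* (r ℚ.* ε) ℚ.+ L ℚ.* (r ℚ.* ε) ≡ ε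
    eq = trans (sym (ℚ.*-distribʳ-+ (r ℚ.* ε) K L))
        (trans (sym (ℚ.*-assoc K+L r ε))
        (trans (cong (ℚ._* ε) (ℚ.*-inverseʳ K+L)) (ℚ.*-identityˡ ε)))

  ∣+∣-bound : ∀ p q {r s} → ℚ.∣ p ∣ ℚ.< r → ℚ.∣ q ∣ ℚ.< s →
              ℚ.∣ p ℚ.+ q ∣ ℚ.< r ℚ.+ s
  ∣+∣-bound p q p<r q<s =
    ℚ.≤-<-trans (ℚ.∣p+q∣≤∣p∣+∣q∣ p q) (ℚ.+-mono-< p<r q<s)

  ∣*∣-bound : ∀ K → ℚ.Positive K → ∀ p q {δ} →
              ℚ.∣ p ∣ ℚ.≤ K → ℚ.∣ q ∣ ℚ.< δ → ℚ.∣ p ℚ.* q ∣ ℚ.< K ℚ.* δ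
  ∣*∣-bound K K>0 p q {δ} p≤K q<δ =
    subst (ℚ._< K ℚ.* δ) (sym (ℚ.∣p*q∣≡∣p∣*∣q∣ p q))
      (ℚ.≤-<-trans
        (ℚ.*-monoʳ-≤-nonNeg ℚ.∣ q ∣ {{ℚ.∣-∣-nonNeg q}} p≤K)
        (ℚ.*-monoʳ-<-pos K {{K>0}} q<δ))

  ∣Δ+∣-bound : ∀ a b c d ε →
    ℚ.∣ a ℚ.- c ∣ ℚ.< ½ ℚ.* ε → ℚ.∣ b ℚ.- d ∣ ℚ.< ½ ℚ.* ε →
    ℚ.∣ (a ℚ.+ b) ℚ.- (c ℚ.+ d) ∣ ℚ.< ε
  ∣Δ+∣-bound a b c d ε h h′ =
    subst₂ (λ u v → ℚ.∣ u ∣ ℚ.< v) (sym (+-regroup a b c d)) (half+half ε)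
      (∣+∣-bound (a ℚ.- c) (b ℚ.- d) h h′)

  ∣Δ*∣-bound : ∀ K L → ℚ.Positive K → ℚ.Positive L → ∀ a b c d δ →
    ℚ.∣ a ∣ ℚ.≤ K → ℚ.∣ d ∣ ℚ.≤ L →
    ℚ.∣ a ℚ.- c ∣ ℚ.< δ → ℚ.∣ b ℚ.- d ∣ ℚ.< δ →
    ℚ.∣ a ℚ.* b ℚ.- c ℚ.* d ∣ ℚ.< K ℚ.* δ ℚ.+ L ℚ.* δ
  ∣Δ*∣-bound K L K>0 L>0 a b c d δ a≤K d≤L h h′ =
    subst (λ u → ℚ.∣ u ∣ ℚ.< K ℚ.* δ ℚ.+ L ℚ.* δ) (sym (*-regroup a b c d))
      (∣+∣-bound (a ℚ.* (b ℚ.- d)) (d ℚ.* (a ℚ.- c))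
        (∣*∣-bound K K>0 a (b ℚ.- d) a≤K h′)
        (∣*∣-bound L L>0 d (a ℚ.- c) d≤L h))

  -- Abstract because unfolding these proofs makes conversion checking of
  -- real-valued terms very slow.
  abstract
    const-cauchy : ∀ q → IsCauchy (λ _ → q)
    const-cauchy q ε p =
      0 , λ _ _ _ _ → subst (λ r → ℚ.∣ r ∣ ℚ.< ε) (sym (ℚ.+-inverseʳ q)) p

    +-cauchy : ∀ {x y} → IsCauchy x → IsCauchy y →
               IsCauchy (λ i → x i ℚ.+ y i)
    +-cauchy {x} {y} cx cy ε p =
      let k , hx = cx _ (half-pos p)
          l , hy = cy _ (half-pos p)
      in k ℕ.⊔ l , λ i j i≥ j≥ → ∣Δ+∣-bound (x i) (y i) (x j) (y j) ε
        (hx i j (ℕ.m⊔n≤o⇒m≤o k l i≥) (ℕ.m⊔n≤o⇒m≤o k l j≥))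
        (hy i j (ℕ.m⊔n≤o⇒n≤o k l i≥) (ℕ.m⊔n≤o⇒n≤o k l j≥))

    neg-cauchy : ∀ {x} → IsCauchy x → IsCauchy (λ i → ℚ.- x i)
    neg-cauchy {x} cx ε p =
      let k , h = cx ε p
      in k , λ i j i≥ j≥ → subst (ℚ._< ε)
        (trans (sym (ℚ.∣-p∣≡∣p∣ (x i ℚ.- x j)))
               (cong ℚ.∣_∣ (neg-regroup (x i) (x j))))
        (h i j i≥ j≥)

    eventually-bounded : ∀ {x} → IsCauchy x →
      Σ[ K ∈ ℚ ] ℚ.Positive K ×
        ∃[ k ] (∀ i → k ℕ.≤ i → ℚ.∣ x i ∣ ℚ.≤ K)
    eventually-bounded {x} cx =
      let k , h = cx 1ℚ (ℚ.positive⁻¹ 1ℚ)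
      in 1ℚ ℚ.+ ℚ.∣ x k ∣
       , ℚ.pos+nonNeg⇒pos 1ℚ ℚ.∣ x k ∣ {{ℚ.∣-∣-nonNeg (x k)}}
       , k
       , λ i i≥ → subst (λ u → ℚ.∣ u ∣ ℚ.≤ 1ℚ ℚ.+ ℚ.∣ x k ∣)
           (sym (split (x i) (x k)))
           (ℚ.≤-trans (ℚ.∣p+q∣≤∣p∣+∣q∣ (x i ℚ.- x k) (x k))
             (ℚ.+-monoˡ-≤ ℚ.∣ x k ∣ (ℚ.<⇒≤ (h i k i≥ ℕ.≤-refl))))

    *-cauchy : ∀ {x y} → IsCauchy x → IsCauchy y →
               IsCauchy (λ i → x i ℚ.* y i)
    *-cauchy {x} {y} cx cy ε p =
      let K , K>0 , k , bx = eventually-bounded cx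
          L , L>0 , l , by = eventually-bounded cy
          δ , δ>0 , eq     = divide K L K>0 L>0 ε p
          k′ , hx          = cx δ δ>0
          l′ , hy          = cy δ δ>0
          kl≥ : ∀ {i} → (k ℕ.⊔ l) ℕ.⊔ (k′ ℕ.⊔ l′) ℕ.≤ i → k ℕ.⊔ l ℕ.≤ i
          kl≥ = ℕ.m⊔n≤o⇒m≤o (k ℕ.⊔ l) (k′ ℕ.⊔ l′)
          kl′≥ : ∀ {i} → (k ℕ.⊔ l) ℕ.⊔ (k′ ℕ.⊔ l′) ℕ.≤ i → k′ ℕ.⊔ l′ ℕ.≤ i
          kl′≥ = ℕ.m⊔n≤o⇒n≤o (k ℕ.⊔ l) (k′ ℕ.⊔ l′)
      in (k ℕ.⊔ l) ℕ.⊔ (k′ ℕ.⊔ l′) , λ i j i≥ j≥ →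
        subst (ℚ.∣ x i ℚ.* y i ℚ.- x j ℚ.* y j ∣ ℚ.<_) eq
          (∣Δ*∣-bound K L K>0 L>0 (x i) (y i) (x j) (y j) δ
            (bx i (ℕ.m⊔n≤o⇒m≤o k l (kl≥ i≥)))
            (by j (ℕ.m⊔n≤o⇒n≤o k l (kl≥ j≥)))
            (hx i j (ℕ.m⊔n≤o⇒m≤o k′ l′ (kl′≥ i≥)) (ℕ.m⊔n≤o⇒m≤o k′ l′ (kl′≥ j≥)))
            (hy i j (ℕ.m⊔n≤o⇒n≤o k′ l′ (kl′≥ i≥)) (ℕ.m⊔n≤o⇒n≤o k′ l′ (kl′≥ j≥))))

infixl 6 _+_ _-_
infixl 7 _*_
infix  8 -_

0ℝ : ℝ
0ℝ = (λ _ → 0ℚ) , const-cauchy 0ℚ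

_+_ _*_ : ℝ → ℝ → ℝ
(x , cx) + (y , cy) = (λ i → x i ℚ.+ y i) , +-cauchy {x} {y} cx cy
(x , cx) * (y , cy) = (λ i → x i ℚ.* y i) , *-cauchy {x} {y} cx cy

-_ : ℝ → ℝ
-_ (x , cx) = (λ i → ℚ.- x i) , neg-cauchy {x} cx

_-_ : ℝ → ℝ → ℝ
x - y = x + (- y)

-- Finite sets are subsets X of some ambient Fin n, so that N and its
-- subset M are handled by the same definitions.

-- The power set of X.  The inclusion proof is irrelevant, so elements
-- with equal underlying subsets are equal.
𝓟 : ∀ {n} → Subset n → Set
𝓟 {n} X = Refinement (Subset n) (_⊆ X)

ℝ^𝓟 : ∀ {n} → Subset n → Set
ℝ^𝓟 X = 𝓟 X → ℝ

ℝ^𝓟-rawLeftModule : ∀ {n} → Subset n → RawLeftModule ℝ 0ℓ 0ℓ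
ℝ^𝓟-rawLeftModule X = record
  { Carrierᴹ = ℝ^𝓟 X
  ; _≈ᴹ_     = λ f g → ∀ S → f S ≈ g S
  ; _+ᴹ_     = λ f g S → f S + g S
  ; _*ₗ_     = λ c f S → c * f S
  ; 0ᴹ       = λ S → 0ℝ
  ; -ᴹ_      = λ f S → - f S
  }

private
  ∪-least : ∀ {n} {A B X : Subset n} → A ⊆ X → B ⊆ X → A ∪ B ⊆ X
  ∪-least {A = A} {B} A⊆X B⊆X x∈A∪B = [ A⊆X , B⊆X ]′ (x∈p∪q⁻ A B x∈A∪B)

module _ {n} {X : Subset n} where

  infixr 6 _∪ᴾ_
  infixr 7 _∩ᴾ_

  _∪ᴾ_ _∩ᴾ_ : 𝓟 X → 𝓟 X → 𝓟 X
  (A , [ A⊆X ]) ∪ᴾ (B , [ B⊆X ]) = A ∪ B , [ (λ x∈ → ∪-least A⊆X B⊆X x∈) ]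
  (A , [ A⊆X ]) ∩ᴾ (B , _) = A ∩ B , [ (λ x∈ → A⊆X (p∩q⊆p A B x∈)) ]

  singletonᴾ : ∀ {a} → a ∈ X → 𝓟 X
  singletonᴾ {a} a∈X =
    ⁅ a ⁆ , [ (λ x∈ → subst (_∈ X) (sym (x∈⁅y⁆⇒x≡y a x∈)) a∈X) ]

Supermodular : ∀ {n} (X : Subset n) → ℝ^𝓟 X → Set
Supermodular X m = ∀ (A B : 𝓟 X) → m A + m B ≤ m (A ∪ᴾ B) + m (A ∩ᴾ B)

𝓚 : ∀ {n} (X : Subset n) → Pred (ℝ^𝓟 X) 0ℓ
𝓚 = Supermodular

record ⟨_,_∣_⟩∈𝓔_ {n} (a b : Fin n) (C X : Subset n) : Set where
  field
    a∈X : a ∈ X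
    b∈X : b ∈ X
    a≢b : a ≢ b
    C⊆  : C ⊆ X ─ (⁅ a ⁆ ∪ ⁅ b ⁆)

-- The left-hand side of the equation defining a ⊥ b ∣ C [m].
Δ : ∀ {n} {X : Subset n} (m : ℝ^𝓟 X) {a b C} → ⟨ a , b ∣ C ⟩∈𝓔 X → ℝ
Δ {X = X} m {a} {b} {C} t =
  m (a′ ∪ᴾ b′ ∪ᴾ C′) + m C′ - m (a′ ∪ᴾ C′) - m (b′ ∪ᴾ C′)
  where
  open ⟨_,_∣_⟩∈𝓔_ t
  a′ b′ C′ : 𝓟 X
  a′ = singletonᴾ a∈X
  b′ = singletonᴾ b∈X
  C′ = C , [ (λ x∈C → p─q⊆p X (⁅ a ⁆ ∪ ⁅ b ⁆) (C⊆ x∈C)) ]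

-- ⟨ a , b ∣ C ⟩ belongs to the independency model induced by m.  It
-- includes ⟨ a , b ∣ C ⟩ ∈ 𝓔(X), which gives sense to the values of m
-- in the equation.
infix 4 _⊥_∣_[_]
_⊥_∣_[_] : ∀ {n} {X : Subset n} →
           Fin n → Fin n → Subset n → ℝ^𝓟 X → Set
_⊥_∣_[_] {X = X} a b C m = Σ[ t ∈ ⟨ a , b ∣ C ⟩∈𝓔 X ] (Δ m t ≈ 0ℝ)

private
  E⊆N : ∀ {n} {M N D E : Subset n} → N ─ M ≡ D ∪ E → E ⊆ N
  E⊆N {M = M} {N} {D} {E} eq {x} x∈E =
    p─q⊆p N M (subst (x ∈_) (sym eq) (q⊆p∪q D E x∈E))

-- The value depends on E only.  The
-- hypotheses ensure S ∪ E ⊆ N.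
T[-_∣_] : ∀ {n} {M N : Subset n} (D E : Subset n) →
          .(M ⊆ N) → .(N ─ M ≡ D ∪ E) → ℝ^𝓟 N → ℝ^𝓟 M
T[-_∣_] {M = M} {N} D E M⊆N N─M≡D∪E m (S , [ S⊆M ]) =
  m (S ∪ E , [ (λ x∈ → ∪-least (λ x∈S → M⊆N (S⊆M x∈S))
                               (E⊆N {M = M} {D = D} N─M≡D∪E) x∈) ])

{-# OPTIONS --safe #-}
-- T m is m precomposed with S ↦ S ∪ E, which preserves unions and
-- intersections, so supermodularity transfers.  Since E is disjoint from M,
-- a and b stay outside C ∪ E, and Δ (T m) at C is literally Δ m at C ∪ E.
module Submission where

open import Defs
open import Algebra.Module.Morphism.Structures using (module LeftModuleMorphisms)
open import Algebra.Properties.IdempotentCommutativeMonoid using (∙-distrʳ-∙)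
open import Data.Fin.Base using (Fin)
open import Data.Fin.Subset using (Subset; _⊆_; _∪_; _∩_; _─_; ∣_∣; ⊥; _∈_; _∉_; ⁅_⁆; inside; outside)
open import Data.Fin.Subset.Properties
open import Data.Nat.Base using (ℕ) renaming (_≤_ to _≤ℕ_)
open import Data.Product.Base using (_×_; _,_)
import Data.Rational as ℚ
import Data.Rational.Properties as ℚ
open import Data.Refinement using (value; value-injective)
open import Data.Sum.Base using ([_,_]′)
open import Data.Vec.Base using (_∷_; here; there)
open import Function.Base using (_∘_)
open import Function.Bundles using (_⇔_; mk⇔)
open import Relation.Binary.PropositionalEquality using (_≡_; refl; sym; trans; cong; cong₂; subst)
open import Relation.Unary using () renaming (_∈_ to _∈ₚ_)

≈-refl : ∀ x → x ≈ x
≈-refl x ε ε>0 = 0 , λ i _ →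
  subst (λ r → ℚ.∣ r ∣ ℚ.< ε) (sym (ℚ.+-inverseʳ (seq x i))) ε>0

-- Splitting on the head of `q` makes the head of `p ─ q` compute. Position zero never belongs to
-- both sets, so only `there` remains in each case.
x∈p─q⇒x∉q : ∀ {n} {x : Fin n} (p q : Subset n) → x ∈ p ─ q → x ∉ q
x∈p─q⇒x∉q (_ ∷ p) (inside  ∷ q) (there x∈p─q) (there x∈q) = x∈p─q⇒x∉q p q x∈p─q x∈q
x∈p─q⇒x∉q (_ ∷ p) (outside ∷ q) (there x∈p─q) (there x∈q) = x∈p─q⇒x∉q p q x∈p─q x∈q

x∈⁅a⁆∪⁅b⁆⇒x∈X : ∀ {n} {a b x : Fin n} {X} → a ∈ X → b ∈ X → x ∈ ⁅ a ⁆ ∪ ⁅ b ⁆ → x ∈ X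
x∈⁅a⁆∪⁅b⁆⇒x∈X {a = a} {b} {X = X} a∈X b∈X =
  [ singleton a a∈X , singleton b b∈X ]′ ∘ x∈p∪q⁻ ⁅ a ⁆ ⁅ b ⁆
  where
  singleton : ∀ c → c ∈ X → ∀ {x} → x ∈ ⁅ c ⁆ → x ∈ X
  singleton c c∈X x∈⁅c⁆ = subst (_∈ X) (sym (x∈⁅y⁆⇒x≡y c x∈⁅c⁆)) c∈X

-- Inclusion proofs in `𝓟 X` are irrelevant, so set identities give `_≡_` between values of `m`.
-- They can then be transported by `subst`, with no congruence lemmas for `_≈_` or `_≤_`.
value-cong : ∀ {n} {X : Subset n} (m : ℝ^𝓟 X) {A B : 𝓟 X} → value A ≡ value B → m A ≡ m B
value-cong m A≡B = cong m (value-injective A≡B)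

module Minor {n} {N M D E : Subset n} (M⊆N : M ⊆ N) (N─M≡D∪E : N ─ M ≡ D ∪ E) where

  T : ℝ^𝓟 N → ℝ^𝓟 M
  T = T[- D ∣ E ] M⊆N N─M≡D∪E

  E⊆N─M : E ⊆ N ─ M
  E⊆N─M {x} x∈E = subst (x ∈_) (sym N─M≡D∪E) (q⊆p∪q D E x∈E)

  T-supermodular : ∀ m → Supermodular N m → Supermodular M (T m)
  T-supermodular m m-super A B =
    subst (T m A + T m B ≤_)
      (cong₂ _+_
        -- Idempotence of `_∪_` merges the two copies of `E` in the union of `A ∪ E` and `B ∪ E`.
        (value-cong m (sym (∙-distrʳ-∙ (∪-idempotentCommutativeMonoid n) E (value A) (value B))))
        (value-cong m (sym (∪-distribʳ-∩ E (value A) (value B)))))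
      -- The arguments are `A ∪ E` and `B ∪ E`, where `m` is by definition `T m` at `A` and `B`.
      (m-super _ _)

  extend : ∀ {a b C} → ⟨ a , b ∣ C ⟩∈𝓔 M → ⟨ a , b ∣ C ∪ E ⟩∈𝓔 N
  extend {a} {b} {C} t = record
    { a∈X = M⊆N a∈X
    ; b∈X = M⊆N b∈X
    ; a≢b = a≢b
    ; C⊆  = [ C⊆N─ab , E⊆N─ab ]′ ∘ x∈p∪q⁻ C E
    }
    where
    open ⟨_,_∣_⟩∈𝓔_ t
    ab = ⁅ a ⁆ ∪ ⁅ b ⁆

    C⊆N─ab : C ⊆ N ─ ab
    C⊆N─ab x∈C = x∈p∧x∉q⇒x∈p─q (M⊆N (p─q⊆p M ab (C⊆ x∈C))) (x∈p─q⇒x∉q M ab (C⊆ x∈C))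

    E⊆N─ab : E ⊆ N ─ ab
    E⊆N─ab x∈E = x∈p∧x∉q⇒x∈p─q (p─q⊆p N M (E⊆N─M x∈E))
      -- An element of `E` equal to `a` or `b` would lie in `M`, as both of these do.
      (x∈p─q⇒x∉q N M (E⊆N─M x∈E) ∘ x∈⁅a⁆∪⁅b⁆⇒x∈X a∈X b∈X)

  -- Only associativity of `_∪_` separates the two sides; the term at `C` itself agrees by `refl`.
  -- Keeping `t′` arbitrary lets both directions of `T-⊥` use it.
  Δ-T : ∀ m {a b C} (t : ⟨ a , b ∣ C ⟩∈𝓔 M) (t′ : ⟨ a , b ∣ C ∪ E ⟩∈𝓔 N) → Δ (T m) t ≡ Δ m t′
  Δ-T m {a} {b} {C} t t′ =
    cong₂ _-_
      (cong₂ _-_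
        (cong₂ _+_
          (value-cong m (trans (∪-assoc ⁅ a ⁆ (⁅ b ⁆ ∪ C) E)
                               (cong (⁅ a ⁆ ∪_) (∪-assoc ⁅ b ⁆ C E))))
          refl)
        (value-cong m (∪-assoc ⁅ a ⁆ C E)))
      (value-cong m (∪-assoc ⁅ b ⁆ C E))

  T-⊥ : ∀ m a b C → ⟨ a , b ∣ C ⟩∈𝓔 M → (a ⊥ b ∣ C [ T m ]) ⇔ (a ⊥ b ∣ C ∪ E [ m ])
  T-⊥ m a b C t = mk⇔
    (λ (s , Δ≈0) → extend s , subst (_≈ 0ℝ) (Δ-T m s (extend s)) Δ≈0)
    -- Here `t` must come from the hypothesis: `t′` only places `a` and `b` in `N`, not in `M`.
    (λ (t′ , Δ≈0) → t , subst (_≈ 0ℝ) (sym (Δ-T m t t′)) Δ≈0)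

  open LeftModuleMorphisms (ℝ^𝓟-rawLeftModule N) (ℝ^𝓟-rawLeftModule M)

  -- The operations are pointwise and `T` is a precomposition, so both sides of each law agree by
  -- computation.
  T-isLeftModuleHomomorphism : IsLeftModuleHomomorphism T
  T-isLeftModuleHomomorphism = record
    { +ᴹ-isGroupHomomorphism = record
      { isMonoidHomomorphism = record
        { isMagmaHomomorphism = record
          { isRelHomomorphism = record { cong = λ f≈g S → f≈g _ }
          ; homo = λ f g S → ≈-refl (T f S + T g S)
          }
        ; ε-homo = λ S → ≈-refl 0ℝ
        }
      ; ⁻¹-homo = λ f S → ≈-refl (- T f S)
      }
    ; *ₗ-homo = λ c f S → ≈-refl (c * T f S)
    }

mainTheorem5 :
  ∀ {n : ℕ} (N M D E : Subset n) → 2 ≤ℕ ∣ N ∣ →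
  (M⊆N : M ⊆ N) (N─M≡D∪E : N ─ M ≡ D ∪ E) → D ∩ E ≡ ⊥ →
  let T = T[- D ∣ E ] M⊆N N─M≡D∪E
      open LeftModuleMorphisms (ℝ^𝓟-rawLeftModule N) (ℝ^𝓟-rawLeftModule M)
  in
  (∀ (m : ℝ^𝓟 N) → m ∈ₚ 𝓚 N →
    T m ∈ₚ 𝓚 M ×
    (∀ a b C → ⟨ a , b ∣ C ⟩∈𝓔 M →
      (a ⊥ b ∣ C [ T m ]) ⇔ (a ⊥ b ∣ C ∪ E [ m ])))
  × (IsLeftModuleHomomorphism T × (∀ m → m ∈ₚ 𝓚 N → T m ∈ₚ 𝓚 M))
mainTheorem5 N M D E _ M⊆N N─M≡D∪E _ =
  (λ m m∈𝓚 → T-supermodular m m∈𝓚 , T-⊥ m)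
  , T-isLeftModuleHomomorphism , T-supermodular
  where open Minor M⊆N N─M≡D∪E
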